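{- For every graph $G$, we have $\lfloor \mathrm{sp}\rfloor(G)\geq|V(G)|-\mathrm{diam}(G)-1$. Moreover, if $\mathrm{usp}(G)\leq\mathrm{diam}(G)$, then $\lfloor \mathrm{sp}\rfloor(G)\geq|V(G)|-\mathrm{diam}(G)$.
   Context: All graphs are finite, have at least one vertex, have no loops, and may have multiple (parallel) edges. $\mathrm{diam}(G)$ is the diameter of $G$ (maximum distance, in number of edges, between two vertices). A unique shortest path is a shortest $u$–$v$ path $P$ such that every $u$–$v$ path with the same number of vertices is identical to $P$, where two paths with different edge sequences are different even if their vertex sequences agree; a single vertex is a unique shortest path. The parade number $\mathrm{usp}(G)$ is the largest number of vertices of a unique shortest path in $G$. The spectator number is $\mathrm{sp}(G)=|V(G)|-\mathrm{usp}(G)$. A minor of $H$ is any graph obtained from $H$ by a sequence of: deleting an isolated vertex, deleting an edge, contracting an edge that has no edge parallel to it. The spectator floor $\lfloor \mathrm{sp}\rfloor(G)$ is the minimum of $\mathrm{sp}(H)$ over all graphs $H$ of which $G$ is a minor. -}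

module Defs where

open import Data.Nat as ℕ using (ℕ; zero; suc; _∸_; _≤_; _<_; NonZero)
import Data.Nat.Properties as ℕ
open import Data.Nat.Induction using (<-rec)
open import Data.Integer as ℤ using (ℤ; +_)
import Data.Fin as Fin
open import Data.Fin using (Fin)
import Data.Fin.Properties as Fin
open import Data.List using (List; []; _∷_; length; concatMap; allFin; upTo; lookup)
open import Data.List.Properties using (≡-dec)
open import Data.List.Relation.Unary.All as All using (All; []; _∷_)
open import Data.List.Relation.Unary.Any as Any using (Any; here; there)
import Data.List.Relation.Unary.Any.Properties as Any
open import Data.List.Relation.Unary.AllPairs using ([]; _∷_)
open import Data.List.Relation.Unary.Unique.Propositional using (Unique)
import Data.List.Relation.Unary.Unique.DecPropositional as DecUnique
open import Data.List.Membership.Propositional using (_∈_)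
open import Data.List.Membership.Propositional.Properties using (∈-allFin; ∈-upTo⁺; ∈-lookup)
import Data.List.Extrema
open import Data.Product using (∃; ∃₂; _×_; _,_; proj₁; proj₂)
open import Data.Sum using (_⊎_; inj₁; inj₂)
open import Level using (0ℓ)
open import Function using (_∘_; _⇔_; id)
open import Function.Definitions using (Injective; Surjective; Bijective)
open import Relation.Binary.Bundles using (TotalOrder)
open import Relation.Binary.PropositionalEquality
open import Relation.Nullary using (¬_; Dec; yes; no; contradiction)
open import Relation.Nullary.Decidable using (_×-dec_; _⊎-dec_; _→-dec_)
open import Relation.Nullary.Construct.Add.Supremum public using (_⁺; ⊤⁺; [_])
open import Relation.Nullary.Construct.Add.Infimum public using (_₋; ⊥₋)
import Relation.Binary.Construct.Add.Supremum.NonStrict as Supremum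
open Supremum ℕ._≤_ public using (_≤⁺_)
open import Relation.Binary.Construct.Add.Infimum.NonStrict ℤ._≤_ public using (_≤₋_)

------------------------------------------------------------------------
-- Multigraphs

-- Edges are undirected: although the ends are stored as end₁ and end₂,
-- everything below is symmetric in the two.

record Graph : Set where
  field
    order       : ℕ
    {{order≢0}} : NonZero order
    size        : ℕ
    end₁ end₂   : Fin size → Fin order
    loopless    : ∀ e → end₁ e ≢ end₂ e

open Graph public using (order; size; end₁; end₂; loopless)

Vertex Edge : Graph → Set
Vertex G = Fin (order G)
Edge   G = Fin (size G)

Joins : (G : Graph) → Edge G → Vertex G → Vertex G → Set
Joins G e u v = (end₁ G e ≡ u × end₂ G e ≡ v) ⊎ (end₁ G e ≡ v × end₂ G e ≡ u)

------------------------------------------------------------------------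
-- Paths

data Walk (G : Graph) : Vertex G → Vertex G → Set where
  nil  : ∀ {u} → Walk G u u
  cons : ∀ {u v w} (e : Edge G) → Joins G e u v → Walk G v w → Walk G u w

vertices : ∀ {G u v} → Walk G u v → List (Vertex G)
vertices (nil {u})        = u ∷ []
vertices (cons {u} _ _ W) = u ∷ vertices W

edges : ∀ {G u v} → Walk G u v → List (Edge G)
edges nil          = []
edges (cons e _ W) = e ∷ edges W

record Path (G : Graph) (u v : Vertex G) : Set where
  constructor path
  field
    walk   : Walk G u v
    simple : Unique (vertices walk)

open Path public using (walk; simple)

#vertices #edges : ∀ {G u v} → Path G u v → ℕ
#vertices P = length (vertices (walk P))
#edges    P = length (edges (walk P))

Identical : ∀ {G u v} → Path G u v → Path G u v → Set
Identical P Q =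
  vertices (walk P) ≡ vertices (walk Q) × edges (walk P) ≡ edges (walk Q)

IsShortest : ∀ {G u v} → Path G u v → Set
IsShortest {G} {u} {v} P = ∀ (Q : Path G u v) → #edges P ≤ #edges Q

IsUniqueShortest : ∀ {G u v} → Path G u v → Set
IsUniqueShortest {G} {u} {v} P =
  IsShortest P × (∀ (Q : Path G u v) → #vertices Q ≡ #vertices P → Identical Q P)

------------------------------------------------------------------------
-- Specifications of the distance, the diameter and the parade number

-- ⊤⁺ is ∞; in particular a disconnected graph has diameter ∞.

IsDistance : (G : Graph) → Vertex G → Vertex G → ℕ ⁺ → Set
IsDistance G u v [ d ] = (∃ λ (P : Path G u v) → #edges P ≡ d)
                       × (∀ (P : Path G u v) → d ≤ #edges P)
IsDistance G u v ⊤⁺    = ¬ Path G u v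

IsDiameter : Graph → ℕ ⁺ → Set
IsDiameter G D = (∃₂ λ u v → IsDistance G u v D)
               × (∀ u v d → IsDistance G u v d → d ≤⁺ D)

IsParadeNumber : Graph → ℕ → Set
IsParadeNumber G k =
    (∃₂ λ u v → ∃ λ (P : Path G u v) → IsUniqueShortest P × #vertices P ≡ k)
  × (∀ u v (P : Path G u v) → IsUniqueShortest P → #vertices P ≤ k)

------------------------------------------------------------------------
-- A complete enumeration of the paths of a graph, used only to show that
-- the above specifications can be met

identical? : ∀ {G u v} (P Q : Path G u v) → Dec (Identical P Q)
identical? P Q = ≡-dec Fin._≟_ _ _ ×-dec ≡-dec Fin._≟_ _ _

joins? : ∀ G e u v → Dec (Joins G e u v)
joins? G e u v = ((end₁ G e Fin.≟ u) ×-dec (end₂ G e Fin.≟ v))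
           ⊎-dec ((end₁ G e Fin.≟ v) ×-dec (end₂ G e Fin.≟ u))

#vertices≡1+#edges : ∀ {G u v} (W : Walk G u v) →
                     length (vertices W) ≡ suc (length (edges W))
#vertices≡1+#edges nil          = refl
#vertices≡1+#edges (cons _ _ W) = cong suc (#vertices≡1+#edges W)

unique⇒lookup-injective : ∀ {A : Set} {xs : List A} → Unique xs →
                          Injective _≡_ _≡_ (lookup xs)
unique⇒lookup-injective (_ ∷ _)  {Fin.zero}  {Fin.zero}  _  = refl
unique⇒lookup-injective (p ∷ _)  {Fin.zero}  {Fin.suc j} eq =
  contradiction eq (All.lookup p (∈-lookup j))
unique⇒lookup-injective (p ∷ _)  {Fin.suc i} {Fin.zero}  eq =
  contradiction (sym eq) (All.lookup p (∈-lookup i))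
unique⇒lookup-injective (_ ∷ ps) {Fin.suc i} {Fin.suc j} eq =
  cong Fin.suc (unique⇒lookup-injective ps eq)

#vertices≤order : ∀ {G u v} (P : Path G u v) → #vertices P ≤ order G
#vertices≤order P = Fin.injective⇒≤ (unique⇒lookup-injective (simple P))

#edges<order : ∀ {G u v} (P : Path G u v) → #edges P < order G
#edges<order P = subst (_≤ _) (#vertices≡1+#edges (walk P)) (#vertices≤order P)

any-concatMap : ∀ {A B : Set} {P : B → Set} {f : A → List B} {x xs} →
                x ∈ xs → Any P (f x) → Any P (concatMap f xs)
any-concatMap {P = P} {f} x∈xs p =
  Any.concat⁺ (Any.map⁺ (Any.map (λ eq → subst (Any P ∘ f) eq p) x∈xs))

SameWalk : ∀ {G u v} → Walk G u v → Walk G u v → Set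
SameWalk V W = vertices V ≡ vertices W × edges V ≡ edges W

module _ (G : Graph) where

  private
    instance _ = Graph.order≢0 G

    empties : ∀ u v → List (Walk G u v)
    empties u v with u Fin.≟ v
    ... | yes refl = nil ∷ []
    ... | no  _    = []

    prepend : ∀ {w v} u e → List (Walk G w v) → List (Walk G u v)
    prepend {w} u e Ws with joins? G e u w
    ... | yes j = Data.List.map (cons e j) Ws
    ... | no  _ = []

    walks : ℕ → ∀ u v → List (Walk G u v)
    walks zero    u v = empties u v
    walks (suc k) u v = concatMap (λ e → concatMap (λ w → prepend u e (walks k w v))
                                                   (allFin (order G)))
                                  (allFin (size G))

    walks-complete : ∀ {u v} (W : Walk G u v) →
                     Any (SameWalk W) (walks (length (edges W)) u v)
    walks-complete (nil {u}) with u Fin.≟ u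
    ... | yes refl = here (refl , refl)
    ... | no  u≢u  = contradiction refl u≢u
    walks-complete (cons {u} {w} {v} e j W) =
      any-concatMap (∈-allFin e) (any-concatMap (∈-allFin w) found)
      where
      found : Any (SameWalk (cons e j W)) (prepend u e (walks (length (edges W)) w v))
      found with joins? G e u w
      ... | yes _ = Any.map⁺ (Any.map (λ (p , q) → cong (u ∷_) p , cong (e ∷_) q)
                                      (walks-complete W))
      ... | no ¬j = contradiction j ¬j

    unique? = DecUnique.unique? (Fin._≟_ {order G})

    simplePaths : ∀ {u v} → Walk G u v → List (Path G u v)
    simplePaths W with unique? (vertices W)
    ... | yes s = path W s ∷ []
    ... | no  _ = []

  paths : ∀ u v → List (Path G u v)
  paths u v = concatMap (λ k → concatMap simplePaths (walks k u v)) (upTo (order G))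

  paths-complete : ∀ {u v} (P : Path G u v) → Any (Identical P) (paths u v)
  paths-complete {u} {v} P =
    any-concatMap (∈-upTo⁺ (#edges<order P))
      (Any.concat⁺ (Any.map⁺ (Any.map found (walks-complete (walk P)))))
    where
    found : ∀ {W} → SameWalk (walk P) W → Any (Identical P) (simplePaths W)
    found {W} (p , q) with unique? (vertices W)
    ... | yes _  = here (p , q)
    ... | no  ¬s = contradiction (subst Unique p (simple P)) ¬s

  all-paths? : ∀ {u v} {R : Path G u v → Set} → (∀ P → Dec (R P)) →
               (∀ {P Q} → Identical P Q → R Q → R P) → Dec (∀ P → R P)
  all-paths? R? resp with All.all? R? (paths _ _)
  ... | yes all = yes λ P → All.lookupWith (λ {Q} r i → resp {P} {Q} i r) all (paths-complete P)
  ... | no ¬all = no λ r → ¬all (All.universal r _)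

  isUniqueShortest? : ∀ {u v} (P : Path G u v) → Dec (IsUniqueShortest P)
  isUniqueShortest? P =
    all-paths? (λ Q → #edges P ℕ.≤? #edges Q)
               (λ (_ , q) → subst (λ es → #edges P ≤ length es) (sym q))
    ×-dec
    all-paths? (λ Q → (#vertices Q ℕ.≟ #vertices P) →-dec identical? Q P)
               (λ (p , q) r eq → let (p′ , q′) = r (trans (cong length (sym p)) eq)
                                 in trans p p′ , trans q q′)

  isUniqueShortest-resp : ∀ {u v} {P Q : Path G u v} → Identical P Q →
                          IsUniqueShortest P → IsUniqueShortest Q
  isUniqueShortest-resp (p , q) (s , t) =
      (λ R → subst (_≤ #edges R) (cong length q) (s R))
    , (λ R eq → let (p′ , q′) = t R (trans eq (cong length (sym p)))
                in trans p′ p , trans q′ q)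

  private
    origin : Vertex G
    origin = Fin.fromℕ< (ℕ.>-nonZero⁻¹ (order G))

    UniqueShortestPath : Set
    UniqueShortestPath = ∃₂ λ u v → ∃ λ (P : Path G u v) → IsUniqueShortest P

    length′ : UniqueShortestPath → ℕ
    length′ (_ , _ , P , _) = #vertices P

    trivial : UniqueShortestPath
    trivial = origin , origin , path nil ([] ∷ []) , (λ _ → ℕ.z≤n) , same
      where
      same : ∀ (Q : Path G origin origin) → #vertices Q ≡ 1 →
             Identical Q (path nil ([] ∷ []))
      same (path nil _)          _  = refl , refl
      same (path (cons _ _ W) _) eq with () ← trans (sym (#vertices≡1+#edges W)) (ℕ.suc-injective eq)

    check : ∀ {u v} → Path G u v → List UniqueShortestPath
    check P with isUniqueShortest? P
    ... | yes s = (_ , _ , P , s) ∷ []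
    ... | no  _ = []

    usps : List UniqueShortestPath
    usps = concatMap (λ u → concatMap (λ v → concatMap check (paths u v))
                                      (allFin (order G)))
                     (allFin (order G))

    usps-complete : ∀ {u v} (P : Path G u v) → IsUniqueShortest P →
                    Any (λ X → #vertices P ≤ length′ X) usps
    usps-complete {u} {v} P s =
      any-concatMap (∈-allFin u) (any-concatMap (∈-allFin v)
        (Any.concat⁺ (Any.map⁺ (Any.map (λ {Q} → found {Q}) (paths-complete P)))))
      where
      found : ∀ {Q} → Identical P Q → Any (λ X → #vertices P ≤ length′ X) (check Q)
      found {Q} i with isUniqueShortest? Q
      ... | yes _  = here (ℕ.≤-reflexive (cong length (proj₁ i)))
      ... | no  ¬s = contradiction (isUniqueShortest-resp {P = P} {Q} i s) ¬s

  ----------------------------------------------------------------------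
  -- The invariants exist. They are opaque so that usp and diam
  -- never unfold to a search; the second components specify them.

  opaque
    paradeNumber : ∃ (IsParadeNumber G)
    paradeNumber = length′ X , (let (u , v , P , s) = X in u , v , P , s , refl)
                 , λ u v P s → E.v≤f[argmax]⁺ trivial usps (inj₂ (usps-complete P s))
      where
      module E = Data.List.Extrema ℕ.≤-totalOrder
      X : UniqueShortestPath
      X = E.argmax length′ trivial usps

  distance : ∀ u v → ∃ (IsDistance G u v)
  distance u v with paths u v | paths-complete {u} {v}
  ... | []     | complete = ⊤⁺ , λ P → contradiction (complete P) λ ()
  ... | P ∷ Ps | complete = [ #edges S ] , (S , refl) , λ Q → least {Q} (complete Q)
    where
    module E = Data.List.Extrema ℕ.≤-totalOrder
    S = E.argmin #edges P Ps
    least : ∀ {Q : Path G u v} → Any (Identical Q) (P ∷ Ps) → #edges S ≤ #edges Q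
    least (here (_ , q))  = E.f[argmin]≤v⁺ {f = #edges} P Ps (inj₁ (ℕ.≤-reflexive (cong length (sym q))))
    least (there i)       = E.f[argmin]≤v⁺ {f = #edges} P Ps
      (inj₂ (Any.map (λ (_ , q) → ℕ.≤-reflexive (cong length (sym q))) i))

  distance-unique : ∀ {u v d d′} → IsDistance G u v d → IsDistance G u v d′ → d ≡ d′
  distance-unique {d = [ d ]} {[ d′ ]} ((P , refl) , l) ((P′ , refl) , l′) =
    cong [_] (ℕ.≤-antisym (l P′) (l′ P))
  distance-unique {d = [ _ ]} {⊤⁺}    ((P , _) , _) ¬P = contradiction P ¬P
  distance-unique {d = ⊤⁺}    {[ _ ]} ¬P ((P , _) , _) = contradiction P ¬P
  distance-unique {d = ⊤⁺}    {⊤⁺}    _ _ = refl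

  opaque
    diameter : ∃ (IsDiameter G)
    diameter = dist X , (proj₁ X , proj₂ X , proj₂ (distance (proj₁ X) (proj₂ X)))
             , λ u v d isD → E.v≤f[argmax]⁺ (origin , origin) pairs (inj₂
                 (any-concatMap (∈-allFin u) (any-concatMap (∈-allFin v)
                   (here (≤⁺.reflexive (distance-unique isD (proj₂ (distance u v))))))))
      where
      ≤⁺-totalOrder : TotalOrder 0ℓ 0ℓ 0ℓ
      ≤⁺-totalOrder = record
        { isTotalOrder = Supremum.≤⁺-isTotalOrder-≡ ℕ._≤_ ℕ.≤-isTotalOrder }
      module ≤⁺ = TotalOrder ≤⁺-totalOrder
      module E = Data.List.Extrema ≤⁺-totalOrder
      dist : Vertex G × Vertex G → ℕ ⁺
      dist (u , v) = proj₁ (distance u v)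
      pairs : List (Vertex G × Vertex G)
      pairs = concatMap (λ u → concatMap (λ v → (u , v) ∷ []) (allFin (order G)))
                        (allFin (order G))
      X : Vertex G × Vertex G
      X = E.argmax dist (origin , origin) pairs

diam : Graph → ℕ ⁺
diam G = proj₁ (diameter G)

usp : Graph → ℕ
usp G = proj₁ (paradeNumber G)

usp≤order : ∀ G → usp G ≤ order G
usp≤order G with (_ , _ , P , _ , eq) , _ ← proj₂ (paradeNumber G) =
  subst (_≤ order G) eq (#vertices≤order P)

-- The subtraction never truncates, by usp≤order.

sp : Graph → ℕ
sp G = order G ∸ usp G

------------------------------------------------------------------------
-- Minors

-- The operations are described up to isomorphism: G arises from H by the
-- named operation if there are maps as specified between G and H.

infix 4 _≅_ _⋖_ _≼_

ImageIsAllBut : {A B : Set} → (A → B) → B → Set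
ImageIsAllBut f b = ∀ y → (∃ λ x → f x ≡ y) ⇔ y ≢ b

record _≅_ (G H : Graph) : Set where
  field
    onV     : Vertex G → Vertex H
    onE     : Edge G → Edge H
    bij-V   : Bijective _≡_ _≡_ onV
    bij-E   : Bijective _≡_ _≡_ onE
    joins   : ∀ e → Joins H (onE e) (onV (end₁ G e)) (onV (end₂ G e))

record IsolatedVertexDeletion (G H : Graph) : Set where
  field
    deleted  : Vertex H
    isolated : ∀ e v → ¬ Joins H e deleted v
    onV      : Vertex G → Vertex H
    onE      : Edge G → Edge H
    inj-V    : Injective _≡_ _≡_ onV
    image-V  : ImageIsAllBut onV deleted
    bij-E    : Bijective _≡_ _≡_ onE
    joins    : ∀ e → Joins H (onE e) (onV (end₁ G e)) (onV (end₂ G e))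

record EdgeDeletion (G H : Graph) : Set where
  field
    deleted : Edge H
    onV     : Vertex G → Vertex H
    onE     : Edge G → Edge H
    bij-V   : Bijective _≡_ _≡_ onV
    inj-E   : Injective _≡_ _≡_ onE
    image-E : ImageIsAllBut onE deleted
    joins   : ∀ e → Joins H (onE e) (onV (end₁ G e)) (onV (end₂ G e))

-- The vertex map goes from H onto G, identifying exactly the two ends of
-- the contracted edge; the edge map still goes from G to H.

record EdgeContraction (G H : Graph) : Set where
  field
    contracted : Edge H
    noParallel : ∀ e → Joins H e (end₁ H contracted) (end₂ H contracted) → e ≡ contracted
    onV        : Vertex H → Vertex G
    onE        : Edge G → Edge H
    surj-V     : Surjective _≡_ _≡_ onV
    kernel-V   : ∀ u v → onV u ≡ onV v ⇔ (u ≡ v ⊎ Joins H contracted u v)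
    inj-E      : Injective _≡_ _≡_ onE
    image-E    : ImageIsAllBut onE contracted
    joins      : ∀ e → Joins G e (onV (end₁ H (onE e))) (onV (end₂ H (onE e)))

data _⋖_ (G H : Graph) : Set where
  deleteVertex : IsolatedVertexDeletion G H → G ⋖ H
  deleteEdge   : EdgeDeletion G H           → G ⋖ H
  contractEdge : EdgeContraction G H        → G ⋖ H

data _≼_ (G : Graph) : Graph → Set where
  iso  : ∀ {H} → G ≅ H → G ≼ H
  step : ∀ {K H} → G ≼ K → K ⋖ H → G ≼ H

------------------------------------------------------------------------
-- The spectator floor

-- The minimum is taken over infinitely many graphs, so it is given as a
-- relation rather than as a function.

IsSpectatorFloor : Graph → ℕ → Set
IsSpectatorFloor G f = (∃ λ H → G ≼ H × sp H ≡ f) × (∀ H → G ≼ H → f ≤ sp H)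

≅-refl : ∀ {G} → G ≅ G
≅-refl = record
  { onV = id ; onE = id
  ; bij-V = id , λ y → y , id ; bij-E = id , λ y → y , id
  ; joins = λ _ → inj₁ (refl , refl) }

spectatorFloor-¬¬exists : ∀ G → ¬ ¬ ∃ (IsSpectatorFloor G)
spectatorFloor-¬¬exists G ¬∃ = <-rec (λ n → ∀ H → G ≼ H → sp H ≢ n)
  (λ n rec H G≼H eq → ¬∃ (n , (H , G≼H , eq) , λ K G≼K →
     ℕ.≮⇒≥ λ spK<n → rec spK<n K G≼K refl))
  (sp G) G (iso ≅-refl) refl

spectatorFloor-unique : ∀ {G f f′} → IsSpectatorFloor G f → IsSpectatorFloor G f′ → f ≡ f′
spectatorFloor-unique ((H , G≼H , refl) , l) ((H′ , G≼H′ , refl) , l′) =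
  ℕ.≤-antisym (l H′ G≼H′) (l′ H G≼H)

------------------------------------------------------------------------
-- Subtraction of a possibly infinite natural number from an integer or −∞

infixl 6 _⊖_

_⊖_ : ℤ ₋ → ℕ ⁺ → ℤ ₋
[ i ] ⊖ [ n ] = [ i ℤ.- + n ]
[ _ ] ⊖ ⊤⁺    = ⊥₋
⊥₋    ⊖ _     = ⊥₋

{-# OPTIONS --safe #-}

-- Let P be a longest unique shortest path of H, and let H contain G as a minor
-- with branch sets B_x.  If P meets a branch set, cut P down to the part M
-- between its first vertex a and its last vertex b lying in branch sets B_x and
-- B_y.  A shortest x–y path Q of G lifts to an a–b path R of H inside the branch
-- sets of the vertices of Q, so |M| ≤ |R|.  The vertices of R, one vertex from
-- each branch set off Q, and the vertices of P outside all branch sets are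
-- pairwise distinct, whence |V(G)| + |R| ≤ sp(H) + |V(Q)| + |M|.  This gives the
-- first bound.  If |V(G)| = sp(H) + diam(G) + 1, then |V(Q)| = diam(G) + 1 and
-- every lift R has the length of M and so equals M; as Q can be recovered from
-- R, it is the only shortest x–y path, and usp(G) > diam(G).

module Submission where

open import Defs
open import Data.Nat using (ℕ)
open import Data.Integer using (+_)
open import Data.Product using (_×_)

open import Data.Nat using (suc; _+_; _≤_; _<_; s≤s)
open import Data.Nat.Properties as ℕ using (≤-refl; ≤-trans; ≤-reflexive)
open import Data.Nat.Solver using (module +-*-Solver)
import Data.Integer as ℤ
import Data.Integer.Properties as ℤ
open import Data.Fin using (Fin)
import Data.Fin.Properties as Fin
open import Data.List using (List; []; _∷_; _++_; length; map; filter; allFin; lookup)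
open import Data.List.Properties
  using (length-++; length-map; length-tabulate; filter-++; filter-none;
         filter-accept; filter-reject; ++-assoc; ++-cancelˡ; ++-cancelʳ; map-injective;
         ∷-injective)
open import Data.List.Relation.Unary.All as All using (All; []; _∷_)
import Data.List.Relation.Unary.All.Properties as All
open import Data.List.Relation.Unary.Any as Any using (here; there; index)
import Data.List.Relation.Unary.Any.Properties as Any
open import Data.List.Relation.Unary.AllPairs using ([]; _∷_)
open import Data.List.Relation.Unary.Unique.Propositional using (Unique)
import Data.List.Relation.Unary.Unique.Propositional.Properties as Unique
open import Data.List.Relation.Binary.Subset.Propositional using (_⊆_)
open import Data.List.Membership.Propositional using (_∈_; _∉_)
open import Data.List.Membership.Propositional.Properties
  using (∈-++⁺ˡ; ∈-++⁺ʳ; ∈-++⁻; ∈-map⁻; ∈-filter⁺; ∈-filter⁻; ∈-lookup)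
import Data.List.Membership.DecPropositional as DecMembership
open import Data.Maybe using (Maybe; just; nothing; _>>=_)
import Data.Maybe.Properties as Maybe
open import Data.Product using (∃; ∃₂; _,_; proj₁; proj₂)
open import Data.Sum using (_⊎_; inj₁; inj₂)
open import Function using (_∘_; Equivalence)
open import Function.Definitions using (Injective; Bijective)
open import Relation.Binary.PropositionalEquality
open import Relation.Nullary using (¬_; Dec; yes; no; contradiction; ¬?)

open _≤₋_ using (⊥₋≤_; [_])
open _≤⁺_ using ([_])

-- Pigeonhole for lists.

unique-⊆⇒length≤ : ∀ {A : Set} {xs ys : List A} → Unique xs → xs ⊆ ys →
                   length xs ≤ length ys
unique-⊆⇒length≤ {xs = xs} {ys} unique xs⊆ys =
  Fin.injective⇒≤ {f = position} λ {i} {j} eq →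
    unique⇒lookup-injective unique (begin
      lookup xs i            ≡⟨ Any.lookup-index (at i) ⟩
      lookup ys (position i) ≡⟨ cong (lookup ys) eq ⟩
      lookup ys (position j) ≡⟨ Any.lookup-index (at j) ⟨
      lookup xs j            ∎)
  where
  open ≡-Reasoning
  at : ∀ i → lookup xs i ∈ ys
  at i = xs⊆ys (∈-lookup i)
  position : Fin (length xs) → Fin (length ys)
  position i = index (at i)

>>=-just⁻ : ∀ {A B : Set} (m : Maybe A) {k : A → Maybe B} {y} → (m >>= k) ≡ just y →
            ∃ λ x → m ≡ just x × k x ≡ just y
>>=-just⁻ (just x) eq = x , refl , eq

-- Walks, and unique shortest walks.

module _ {G : Graph} where

  joins-sym : ∀ {e u v} → Joins G e u v → Joins G e v u
  joins-sym (inj₁ p) = inj₂ p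
  joins-sym (inj₂ p) = inj₁ p

  joins⇒≢ : ∀ {e u v} → Joins G e u v → u ≢ v
  joins⇒≢ {e} (inj₁ (refl , refl)) eq = loopless G e eq
  joins⇒≢ {e} (inj₂ (refl , refl)) eq = loopless G e (sym eq)

  joins-functional : ∀ {e u v w} → Joins G e u v → Joins G e u w → v ≡ w
  joins-functional     (inj₁ (_ , p))    (inj₁ (_ , q))    = trans (sym p) q
  joins-functional {e} (inj₁ (p , _))    (inj₂ (_ , q))    =
    contradiction (trans p (sym q)) (loopless G e)
  joins-functional {e} (inj₂ (_ , p))    (inj₁ (q , _))    =
    contradiction (trans q (sym p)) (loopless G e)
  joins-functional     (inj₂ (p , _))    (inj₂ (q , _))    = trans (sym p) q

  -- From the common start, looplessness fixes the other end of each edge in turn. The final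
  -- argument recovers a path only by its edges, while `Identical` also compares vertices.
  edges-determine-vertices : ∀ {u v w} (V : Walk G u v) (W : Walk G u w) →
                             edges V ≡ edges W → vertices V ≡ vertices W
  edges-determine-vertices nil          nil           _  = refl
  edges-determine-vertices (cons e j V) (cons e′ k W) eq
    with refl , eq′ ← ∷-injective eq
    with refl ← joins-functional j k = cong (_ ∷_) (edges-determine-vertices V W eq′)

  all-start : ∀ {P : Vertex G → Set} {u v} (W : Walk G u v) → All P (vertices W) → P u
  all-start nil          (p ∷ _) = p
  all-start (cons _ _ _) (p ∷ _) = p

  infixr 5 _++ʷ_

  _++ʷ_ : ∀ {u v w} → Walk G u v → Walk G v w → Walk G u w
  nil        ++ʷ W = W
  cons e j V ++ʷ W = cons e j (V ++ʷ W)

  edges-++ʷ : ∀ {u v w} (V : Walk G u v) (W : Walk G v w) →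
              edges (V ++ʷ W) ≡ edges V ++ edges W
  edges-++ʷ nil          W = refl
  edges-++ʷ (cons e j V) W = cong (e ∷_) (edges-++ʷ V W)

  vertices-++ʷ-cons : ∀ {u v w z} (V : Walk G u v) {e} {j : Joins G e v w} (W : Walk G w z) →
                      vertices (V ++ʷ cons e j W) ≡ vertices V ++ vertices W
  vertices-++ʷ-cons nil              W = refl
  vertices-++ʷ-cons (cons {u} _ _ V) W = cong (u ∷_) (vertices-++ʷ-cons V W)

  suffixFrom : ∀ {u v w} (W : Walk G u v) → Unique (vertices W) → w ∈ vertices W →
               ∃ λ (P : Path G w v) → #edges P ≤ length (edges W)
  suffixFrom nil            s       (here refl)  = path nil s , ≤-refl
  suffixFrom W@(cons _ _ _) s       (here refl)  = path W s , ≤-refl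
  suffixFrom (cons _ _ W)   (_ ∷ s) (there w∈W)  =
    let P , le = suffixFrom W s w∈W in P , ℕ.m≤n⇒m≤1+n le

  -- When the shortened rest of the walk returns to `u`, everything before that return is dropped,
  -- and with it at least the edge `e`. Any change thus costs length, so that a walk is either
  -- simple already or beaten by a path.
  shorten : ∀ {u v} (W : Walk G u v) →
            ∃ λ (P : Path G u v) → edges (walk P) ≡ edges W ⊎ #edges P < length (edges W)
  shorten nil = path nil ([] ∷ []) , inj₁ refl
  shorten (cons {u} e j W) with P , same-or-shorter ← shorten W
                           with DecMembership._∈?_ Fin._≟_ u (vertices (walk P))
  ... | yes u∈P = let S , le = suffixFrom (walk P) (simple P) u∈P
                  in S , inj₂ (s≤s (≤-trans le (noLonger same-or-shorter)))
    where
    noLonger : edges (walk P) ≡ edges W ⊎ #edges P < length (edges W) →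
               #edges P ≤ length (edges W)
    noLonger (inj₁ eq) = ≤-reflexive (cong length eq)
    noLonger (inj₂ lt) = ℕ.<⇒≤ lt
  ... | no u∉P = path (cons e j (walk P)) (All.¬Any⇒All¬ _ u∉P ∷ simple P) , extend same-or-shorter
    where
    extend : edges (walk P) ≡ edges W ⊎ #edges P < length (edges W) →
             e ∷ edges (walk P) ≡ e ∷ edges W ⊎ suc (#edges P) < suc (length (edges W))
    extend (inj₁ eq) = inj₁ (cong (e ∷_) eq)
    extend (inj₂ lt) = inj₂ (s≤s lt)

  -- Unlike IsUniqueShortest, this compares with all walks, which makes it pass to
  -- subwalks by mere concatenation.
  IsUniqueShortestWalk : ∀ {u v} → Walk G u v → Set
  IsUniqueShortestWalk {u} {v} W =
    ∀ (V : Walk G u v) → length (edges V) ≤ length (edges W) → edges V ≡ edges W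

  -- If `shorten` makes `V` strictly shorter, the result is a path shorter than `P`, which is
  -- impossible. Otherwise it is a path with the edges of `V` and the length of `P`, to which
  -- uniqueness among paths applies.
  uniqueShortest⇒walk : ∀ {u v} (P : Path G u v) → IsUniqueShortest P →
                        IsUniqueShortestWalk (walk P)
  uniqueShortest⇒walk P (shortest , unique) V V≤P with shorten V
  ... | Q , inj₂ Q<V = contradiction (≤-trans Q<V (≤-trans V≤P (shortest Q))) (ℕ.<-irrefl refl)
  ... | Q , inj₁ Q≡V = trans (sym Q≡V) (proj₂ (unique Q (begin
    #vertices Q    ≡⟨ #vertices≡1+#edges (walk Q) ⟩
    suc (#edges Q) ≡⟨ cong suc (ℕ.≤-antisym (subst (λ es → length es ≤ _) (sym Q≡V) V≤P) (shortest Q)) ⟩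
    suc (#edges P) ≡⟨ #vertices≡1+#edges (walk P) ⟨
    #vertices P    ∎)))
    where open ≡-Reasoning

  -- Putting `N` in place of `M` inside `W` gives a walk no longer than `W`, hence one with the same
  -- edges; the common prefix and suffix then cancel.
  uniqueShortest-infix : ∀ {u a b v} {W : Walk G u v}
                         (A : Walk G u a) (M : Walk G a b) (C : Walk G b v) →
                         edges W ≡ edges A ++ edges M ++ edges C →
                         IsUniqueShortestWalk W → IsUniqueShortestWalk M
  uniqueShortest-infix {W = W} A M C W≡AMC unique N N≤M =
    ++-cancelʳ (edges C) _ _ (++-cancelˡ (edges A) _ _ (begin
      edges A ++ edges N ++ edges C ≡⟨ edges-ANC ⟨
      edges (A ++ʷ N ++ʷ C)         ≡⟨ unique (A ++ʷ N ++ʷ C) ANC≤W ⟩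
      edges W                       ≡⟨ W≡AMC ⟩
      edges A ++ edges M ++ edges C ∎))
    where
    open ≡-Reasoning
    length-++₃ : ∀ (as bs cs : List (Edge G)) →
                 length (as ++ bs ++ cs) ≡ length as + (length bs + length cs)
    length-++₃ as bs cs = trans (length-++ as) (cong₂ _+_ refl (length-++ bs))
    edges-ANC : edges (A ++ʷ N ++ʷ C) ≡ edges A ++ edges N ++ edges C
    edges-ANC = trans (edges-++ʷ A (N ++ʷ C)) (cong (edges A ++_) (edges-++ʷ N C))
    ANC≤W : length (edges (A ++ʷ N ++ʷ C)) ≤ length (edges W)
    ANC≤W = subst₂ _≤_
      (sym (trans (cong length edges-ANC) (length-++₃ (edges A) (edges N) (edges C))))
      (sym (trans (cong length W≡AMC) (length-++₃ (edges A) (edges M) (edges C))))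
      (ℕ.+-monoʳ-≤ (length (edges A)) (ℕ.+-monoˡ-≤ (length (edges C)) N≤M))

-- Branch-set models of minors, and lifting of paths.

-- The branch set of x is the set of all a with branch a ≡ just x.

record Model (G H : Graph) : Set where
  field
    branch      : Vertex H → Maybe (Vertex G)
    inhabited   : ∀ x → ∃ λ a → branch a ≡ just x
    connected   : ∀ {x a b} → branch a ≡ just x → branch b ≡ just x →
                  ∃ λ (P : Path H a b) → All (λ c → branch c ≡ just x) (vertices (walk P))
    onE         : Edge G → Edge H
    onE-inj     : Injective _≡_ _≡_ onE
    onE-joins   : ∀ e → ∃₂ λ a b → Joins H (onE e) a b
                                 × branch a ≡ just (end₁ G e) × branch b ≡ just (end₂ G e)

  InBranches : List (Vertex G) → Vertex H → Set
  InBranches xs a = ∃ λ x → x ∈ xs × branch a ≡ just x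

  Outside : Vertex H → Set
  Outside a = branch a ≡ nothing

  outside? : ∀ a → Dec (Outside a)
  outside? a = Maybe.≡-dec Fin._≟_ (branch a) nothing

  -- On a lifted path the crossing edges are exactly the images of the edges of the original path;
  -- filtering by `Crossing` therefore reads the original off its lift.
  Crossing : Edge H → Set
  Crossing e = branch (end₁ H e) ≢ branch (end₂ H e)

  crossing? : ∀ e → Dec (Crossing e)
  crossing? e = ¬? (Maybe.≡-dec Fin._≟_ (branch (end₁ H e)) (branch (end₂ H e)))

  onE-joins′ : ∀ {e x y} → Joins G e x y →
               ∃₂ λ a b → Joins H (onE e) a b × branch a ≡ just x × branch b ≡ just y
  onE-joins′ {e} (inj₁ (refl , refl)) = onE-joins e
  onE-joins′ {e} (inj₂ (refl , refl)) =
    let a , b , j , p , q = onE-joins e in b , a , joins-sym {H} j , q , p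

  branch-≢⇒crossing : ∀ {e a b} → Joins H e a b → branch a ≢ branch b → Crossing e
  branch-≢⇒crossing (inj₁ (refl , refl)) ≢ = ≢
  branch-≢⇒crossing (inj₂ (refl , refl)) ≢ = ≢ ∘ sym

  branch-≡⇒¬crossing : ∀ {e a b} → Joins H e a b → branch a ≡ branch b → ¬ Crossing e
  branch-≡⇒¬crossing (inj₁ (refl , refl)) eq ≢ = ≢ eq
  branch-≡⇒¬crossing (inj₂ (refl , refl)) eq ≢ = ≢ (sym eq)

  withinBranch⇒¬crossing : ∀ {x a b} (W : Walk H a b) →
                           All (λ c → branch c ≡ just x) (vertices W) →
                           All (¬_ ∘ Crossing) (edges W)
  withinBranch⇒¬crossing nil          _        = []
  withinBranch⇒¬crossing (cons _ j W) (p ∷ ps) =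
    branch-≡⇒¬crossing j (trans p (sym (all-start W ps))) ∷ withinBranch⇒¬crossing W ps

  -- The images of the edges of `W` are linked by paths inside the branch sets of its vertices. The
  -- result is simple because `W` repeats no vertex and distinct branch sets are disjoint. Edges
  -- inside a branch set do not cross, which leaves the images alone after filtering.
  lift : ∀ {x y a b} (W : Walk G x y) → Unique (vertices W) →
         branch a ≡ just x → branch b ≡ just y →
         ∃ λ (R : Path H a b) → All (InBranches (vertices W)) (vertices (walk R))
                              × filter crossing? (edges (walk R)) ≡ map onE (edges W)
  lift {x} nil _ p q with S , inS ← connected p q =
    S , All.map (λ eq → x , here refl , eq) inS
      , filter-none crossing? (withinBranch⇒¬crossing (walk S) inS)
  lift {x} (cons e j W) (x∉W ∷ s) p q
    with c , d , j′ , pc , pd ← onE-joins′ j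
    with S , inS ← connected p pc
    with R , inR , crossR ← lift W s pd q =
      path (walk S ++ʷ cons (onE e) j′ (walk R))
           (subst Unique (sym vs) (Unique.++⁺ (simple S) (simple R) disjoint))
    , subst (All _) (sym vs)
        (All.++⁺ (All.map (λ eq → x , here refl , eq) inS)
                 (All.map (λ (y , y∈W , eq) → y , there y∈W , eq) inR))
    , (begin
        filter crossing? (edges (walk S ++ʷ cons (onE e) j′ (walk R)))
          ≡⟨ cong (filter crossing?) (edges-++ʷ (walk S) _) ⟩
        filter crossing? (edges (walk S) ++ onE e ∷ edges (walk R))
          ≡⟨ filter-++ crossing? (edges (walk S)) _ ⟩
        filter crossing? (edges (walk S)) ++ filter crossing? (onE e ∷ edges (walk R))
          ≡⟨ cong₂ _++_ (filter-none crossing? (withinBranch⇒¬crossing (walk S) inS))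
                        (filter-accept crossing? (branch-≢⇒crossing j′ c≁d)) ⟩
        onE e ∷ filter crossing? (edges (walk R))
          ≡⟨ cong (onE e ∷_) crossR ⟩
        onE e ∷ map onE (edges W) ∎)
    where
    open ≡-Reasoning
    vs = vertices-++ʷ-cons (walk S) (walk R)
    c≁d : branch c ≢ branch d
    c≁d eq = joins⇒≢ {G} {e} j (Maybe.just-injective (trans (sym pc) (trans eq pd)))
    disjoint : ∀ {v} → ¬ (v ∈ vertices (walk S) × v ∈ vertices (walk R))
    disjoint (v∈S , v∈R) with y , y∈W , eq ← All.lookup inR v∈R =
      All.lookup x∉W y∈W (Maybe.just-injective (trans (sym (All.lookup inS v∈S)) eq))

  -- Counting the vertices of the larger graph.

  section : Vertex G → Vertex H
  section x = proj₁ (inhabited x)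

  section-inj : ∀ {x y} → section x ≡ section y → x ≡ y
  section-inj {x} {y} eq = Maybe.just-injective
    (trans (sym (proj₂ (inhabited x))) (trans (cong branch eq) (proj₂ (inhabited y))))

  -- Three disjoint sets of vertices of `H` are counted: those of `R`, in branch sets of members of
  -- `xs`; one representative of every other branch set; and the vertices of `P` in no branch set.
  -- The term `length xs` pays for the members of `xs`, which get no representative.
  order-bound : ∀ {xs R P} → Unique R → All (InBranches xs) R → Unique P →
                length R + order G + length (filter outside? P) ≤ order H + length xs
  order-bound {xs} {R} {P} uniqueR inR uniqueP = begin
    length R + order G + length outs
      ≤⟨ ℕ.+-monoˡ-≤ (length outs) (ℕ.+-monoʳ-≤ (length R) order≤) ⟩
    length R + (length rest + length xs) + length outs
      ≡⟨ solve 4 (λ r k x o → r :+ (k :+ x) :+ o := r :+ (k :+ o) :+ x) refl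
           (length R) (length rest) (length xs) (length outs) ⟩
    length R + (length rest + length outs) + length xs
      ≡⟨ cong (_+ length xs) (sym lengths) ⟩
    length (R ++ map section rest ++ outs) + length xs
      ≤⟨ ℕ.+-monoˡ-≤ (length xs) (Fin.injective⇒≤ (unique⇒lookup-injective unique)) ⟩
    order H + length xs ∎
    where
    open ℕ.≤-Reasoning
    open +-*-Solver
    _∈?_ = DecMembership._∈?_ (Fin._≟_ {order G})
    rest = filter (λ x → ¬? (x ∈? xs)) (allFin (order G))
    outs = filter outside? P

    covered : allFin (order G) ⊆ rest ++ xs
    covered {x} x∈ with x ∈? xs
    ... | yes x∈xs = ∈-++⁺ʳ rest x∈xs
    ... | no  x∉xs = ∈-++⁺ˡ (∈-filter⁺ (λ x → ¬? (x ∈? xs)) x∈ x∉xs)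

    order≤ : order G ≤ length rest + length xs
    order≤ = subst₂ _≤_ (length-tabulate {n = order G} (λ i → i)) (length-++ rest)
      (unique-⊆⇒length≤ (Unique.allFin⁺ (order G)) covered)

    lengths : length (R ++ map section rest ++ outs) ≡ length R + (length rest + length outs)
    lengths = trans (length-++ R) (cong₂ _+_ refl
      (trans (length-++ (map section rest)) (cong (_+ length outs) (length-map section rest))))

    branch-rest : ∀ {v} → v ∈ map section rest → ∃ λ x → x ∉ xs × branch v ≡ just x
    branch-rest v∈ with x , x∈rest , refl ← ∈-map⁻ section v∈ =
      x , proj₂ (∈-filter⁻ (λ x → ¬? (x ∈? xs)) {xs = allFin _} x∈rest) , proj₂ (inhabited x)

    branch-outs : ∀ {v} → v ∈ outs → branch v ≡ nothing
    branch-outs v∈ = proj₂ (∈-filter⁻ outside? {xs = P} v∈)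

    disjoint-rest-outs : ∀ {v} → ¬ (v ∈ map section rest × v ∈ outs)
    disjoint-rest-outs (v∈rest , v∈outs)
      with () ← trans (sym (proj₂ (proj₂ (branch-rest v∈rest)))) (branch-outs v∈outs)

    disjoint : ∀ {v} → ¬ (v ∈ R × v ∈ map section rest ++ outs)
    disjoint (v∈R , v∈) with y , y∈xs , eq ← All.lookup inR v∈R
                        with ∈-++⁻ (map section rest) v∈
    ... | inj₂ v∈outs with () ← trans (sym eq) (branch-outs v∈outs)
    ... | inj₁ v∈rest with x , x∉xs , eq′ ← branch-rest v∈rest =
      x∉xs (subst (_∈ xs) (Maybe.just-injective (trans (sym eq) eq′)) y∈xs)

    unique : Unique (R ++ map section rest ++ outs)
    unique = Unique.++⁺ uniqueR
      (Unique.++⁺ (Unique.map⁺ section-inj (Unique.filter⁺ _ (Unique.allFin⁺ (order G))))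
                  (Unique.filter⁺ outside? uniqueP) disjoint-rest-outs)
      disjoint

  -- Trimming a path to its first and last vertex in a branch set.

  #outside : ∀ {u v} → Walk H u v → ℕ
  #outside W = length (filter outside? (vertices W))

  -- That all vertices of `W` off `middle` lie outside the branch sets is kept only through its
  -- numerical consequence `counts`, in which `suc (length (edges middle))` is the number of
  -- vertices of `middle`.
  record Trimming {u v} (W : Walk H u v) : Set where
    no-eta-equality
    pattern
    constructor trimming
    field
      {start stop} : Vertex H
      {x y}        : Vertex G
      start∈x      : branch start ≡ just x
      stop∈y       : branch stop ≡ just y
      before       : Walk H u start
      middle       : Walk H start stop
      after        : Walk H stop v
      decomposes   : edges W ≡ edges before ++ edges middle ++ edges after
      counts       : length (vertices W) ≤ #outside W + suc (length (edges middle))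

  #outside-skip : ∀ {a x} as → branch a ≡ just x →
                  length (filter outside? (a ∷ as)) ≡ length (filter outside? as)
  #outside-skip as eq = cong length (filter-reject outside? {xs = as} λ out →
    contradiction (trans (sym eq) out) λ ())

  #outside-suc : ∀ {a} as → Outside a →
                 length (filter outside? (a ∷ as)) ≡ suc (length (filter outside? as))
  #outside-suc as out = cong length (filter-accept outside? {xs = as} out)

  -- The first alternative says, in the form needed for counting, that `W` avoids all branch sets.
  trim : ∀ {u v} (W : Walk H u v) → length (vertices W) ≤ #outside W ⊎ Trimming W
  trim (nil {u}) with branch u in eq
  ... | nothing = inj₁ ≤-refl
  ... | just x  = inj₂ (trimming eq eq nil nil nil refl (ℕ.m≤n+m 1 _))
  trim (cons {u} e j W) with branch u in eq | trim W
  ... | nothing | inj₁ le = inj₁ (s≤s le)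
  ... | nothing | inj₂ (trimming p q A M C dec le) =
    inj₂ (trimming p q (cons e j A) M C (cong (e ∷_) dec)
      (subst (λ o → _ ≤ o + _) (sym (#outside-suc (vertices W) eq)) (s≤s le)))
  -- Here `u` is the only vertex in a branch set, hence both the first and the last.
  ... | just x  | inj₁ le =
    inj₂ (trimming eq eq nil nil (cons e j W) refl
      (subst₂ (λ o s → s ≤ o + 1) (sym (#outside-skip (vertices W) eq)) (ℕ.+-comm _ 1)
              (ℕ.+-monoˡ-≤ 1 le)))
  -- Now `u` is the first vertex in a branch set, and the old `before` part joins the middle.
  ... | just x  | inj₂ (trimming p q A M C dec le) =
    inj₂ (trimming eq q nil (cons e j (A ++ʷ M)) C
      (cong (e ∷_) (trans dec (trans (sym (++-assoc (edges A) _ _))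
                                     (cong (_++ edges C) (sym (edges-++ʷ A M))))))
      (subst (λ o → _ ≤ o + _) (sym (#outside-skip (vertices W) eq))
        (≤-trans (s≤s le) (subst (_≤ #outside W + suc (suc (length (edges (A ++ʷ M)))))
                                 (ℕ.+-suc (#outside W) _)
                                 (ℕ.+-monoʳ-≤ (#outside W) (s≤s (s≤s longer)))))))
    where
    longer : length (edges M) ≤ length (edges (A ++ʷ M))
    longer = subst (length (edges M) ≤_)
      (sym (trans (cong length (edges-++ʷ A M)) (length-++ (edges A))))
      (ℕ.m≤n+m _ _)

-- A longest unique shortest path of the larger graph against paths of the minor.

usp+sp : ∀ H → usp H + sp H ≡ order H
usp+sp H = ℕ.m+[n∸m]≡n (usp≤order H)

module _ {G H : Graph} (M : Model G H) where
  open Model M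

  meets-no-branch : ∀ {u v} (P : Path H u v) → #vertices P ≡ usp H →
                    #vertices P ≤ #outside (walk P) → order G ≤ sp H
  meets-no-branch P #P≡usp le = ℕ.+-cancelˡ-≤ (usp H) _ _ (begin
    usp H + order G                ≡⟨ ℕ.+-comm (usp H) _ ⟩
    order G + usp H                ≡⟨ cong₂ _+_ refl #P≡usp ⟨
    order G + #vertices P          ≤⟨ ℕ.+-monoʳ-≤ (order G) le ⟩
    order G + #outside (walk P)    ≤⟨ order-bound {xs = []} [] [] (simple P) ⟩
    order H + 0                    ≡⟨ ℕ.+-identityʳ _ ⟩
    order H                        ≡⟨ usp+sp H ⟨
    usp H + sp H                   ∎)
    where open ℕ.≤-Reasoning

  -- In the sum of `counts` and `order-bound`, the vertices of `P` outside the branch sets cancel.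
  -- As `P` has `usp H` vertices, `order H` is `#vertices P + sp H`, and `#vertices P` cancels too.
  lift-bound : ∀ {u v} (P : Path H u v) → #vertices P ≡ usp H → (T : Trimming (walk P)) →
               let open Trimming T in
               (Q : Path G x y) (R : Path H start stop) →
               All (InBranches (vertices (walk Q))) (vertices (walk R)) →
               order G + #edges R ≤ sp H + #vertices Q + length (edges middle)
  lift-bound P #P≡usp T Q R inR = ℕ.+-cancelˡ-≤ (#vertices P) _ _ (begin
    #vertices P + (order G + #edges R)
      ≤⟨ ℕ.+-monoˡ-≤ (order G + #edges R) counts ⟩
    (#outside (walk P) + suc m) + (order G + #edges R)
      -- The 1 that makes `m` a number of vertices is handed to `R`, whose vertices `order-bound`
      -- counts.
      ≡⟨ solve 4 (λ o m n r → (o :+ (con 1 :+ m)) :+ (n :+ r) := ((con 1 :+ r) :+ n :+ o) :+ m)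
           refl (#outside (walk P)) m (order G) (#edges R) ⟩
    (suc (#edges R) + order G + #outside (walk P)) + m
      ≤⟨ ℕ.+-monoˡ-≤ m (subst (λ r → r + order G + #outside (walk P) ≤ order H + #vertices Q)
                              (#vertices≡1+#edges (walk R))
                              (order-bound (simple R) inR (simple P))) ⟩
    (order H + #vertices Q) + m
      ≡⟨ cong (λ h → h + #vertices Q + m) (sym (usp+sp H)) ⟩
    (usp H + sp H + #vertices Q) + m
      ≡⟨ cong (λ p → p + sp H + #vertices Q + m) (sym #P≡usp) ⟩
    (#vertices P + sp H + #vertices Q) + m
      ≡⟨ solve 4 (λ p s q m → (p :+ s :+ q) :+ m := p :+ (s :+ q :+ m))
           refl (#vertices P) (sp H) (#vertices Q) m ⟩
    #vertices P + (sp H + #vertices Q + m) ∎)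
    where
    open ℕ.≤-Reasoning
    open +-*-Solver
    open Trimming T
    m = length (edges middle)

  -- The ends `x`, `y` and the list `es` come from the middle part of the path in `H` and are fixed
  -- before `Q`. The middle is no longer than any lift of `Q`, which gives the inequality. In the
  -- tight case the lift is no longer than the middle either, so it has the same edges, and their
  -- crossing edges are `es`.
  order-dichotomy :
    order G ≤ sp H ⊎
    ∃₂ λ x y → ∃ λ es → ∀ (Q : Path G x y) →
      order G ≤ sp H + #vertices Q ×
      (sp H + #vertices Q ≤ order G → map onE (edges (walk Q)) ≡ es)
  order-dichotomy with (_ , _ , P , isUSP , #P≡usp) , _ ← proj₂ (paradeNumber H)
                  with trim (walk P)
  ... | inj₁ le = inj₁ (meets-no-branch P #P≡usp le)
  ... | inj₂ T  = inj₂ (x , y , filter crossing? (edges middle) , λ Q →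
      let R , inR , crossR = lift (walk Q) (simple Q) start∈x stop∈y
          bound = lift-bound P #P≡usp T Q R inR
      in ℕ.+-cancelʳ-≤ m _ _ (≤-trans (ℕ.+-monoʳ-≤ (order G) (middle≤ R)) bound)
       , λ tight → trans (sym crossR) (cong (filter crossing?) (middle-unique (walk R)
           (ℕ.+-cancelˡ-≤ (order G) _ _ (≤-trans bound (ℕ.+-monoˡ-≤ m tight))))))
    where
    open Trimming T
    m = length (edges middle)
    middle-unique : IsUniqueShortestWalk middle
    middle-unique = uniqueShortest-infix before middle after decomposes (uniqueShortest⇒walk P isUSP)
    middle≤ : (R : Path H start stop) → m ≤ #edges R
    -- Minimality follows from uniqueness: a walk that is no longer has the same edges, hence the
    -- same length.
    middle≤ R with ℕ.≤-total m (#edges R)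
    ... | inj₁ le = le
    ... | inj₂ ge = ≤-reflexive (cong length (sym (middle-unique (walk R) ge)))

-- From minor operations to models.

-- For connectedness, a path inside a branch set of `M` is lifted through `N`; the lift stays in the
-- branch sets of the vertices of that path.
compose : ∀ {G K H} → Model G K → Model K H → Model G H
compose {G} {K} {H} M N = record
  { branch    = λ a → N.branch a >>= M.branch
  ; inhabited = λ x → let k , p = M.inhabited x
                          a , q = N.inhabited k
                      in a , glue q p
  ; connected = conn
  ; onE       = N.onE ∘ M.onE
  ; onE-inj   = M.onE-inj ∘ N.onE-inj
  ; onE-joins = λ e → let k , l , j , p , q = M.onE-joins e
                          a , b , i , r , s = N.onE-joins′ j
                      in a , b , i , glue r p , glue s q
  }
  where
  module M = Model M
  module N = Model N
  glue : ∀ {a k x} → N.branch a ≡ just k → M.branch k ≡ x → (N.branch a >>= M.branch) ≡ x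
  glue p q rewrite p = q
  conn : ∀ {x a b} → (N.branch a >>= M.branch) ≡ just x → (N.branch b >>= M.branch) ≡ just x →
         ∃ λ (P : Path H a b) → All (λ c → (N.branch c >>= M.branch) ≡ just x) (vertices (walk P))
  conn {x} {a} {b} p q with k , p₁ , p₂ ← >>=-just⁻ (N.branch a) p
                       with l , q₁ , q₂ ← >>=-just⁻ (N.branch b) q
                       with S , inS ← M.connected p₂ q₂
                       with R , inR , _ ← N.lift (walk S) (simple S) p₁ q₁ =
    R , All.map (λ (k , k∈S , eq) → glue eq (All.lookup inS k∈S)) inR

-- Covers isomorphisms and both deletions, where each branch set is the single vertex `onV x`.
singletonBranches⇒model : ∀ {G H} (branch : Vertex H → Maybe (Vertex G))
             (onV : Vertex G → Vertex H) (onE : Edge G → Edge H) →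
             (∀ x → branch (onV x) ≡ just x) →
             (∀ {a x} → branch a ≡ just x → a ≡ onV x) →
             Injective _≡_ _≡_ onE →
             (∀ e → Joins H (onE e) (onV (end₁ G e)) (onV (end₂ G e))) →
             Model G H
singletonBranches⇒model {G} {H} branch onV onE branch-onV branch⁻ inj joins = record
  { branch    = branch
  ; inhabited = λ x → onV x , branch-onV x
  ; connected = conn
  ; onE       = onE
  ; onE-inj   = inj
  ; onE-joins = λ e → _ , _ , joins e , branch-onV _ , branch-onV _
  }
  where
  conn : ∀ {x a b} → branch a ≡ just x → branch b ≡ just x →
         ∃ λ (P : Path H a b) → All (λ c → branch c ≡ just x) (vertices (walk P))
  conn p q with refl ← branch⁻ p | refl ← branch⁻ q = path nil ([] ∷ []) , p ∷ []

bijective⇒model : ∀ {G H} (onV : Vertex G → Vertex H) (onE : Edge G → Edge H) →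
                  Bijective _≡_ _≡_ onV → Injective _≡_ _≡_ onE →
                  (∀ e → Joins H (onE e) (onV (end₁ G e)) (onV (end₂ G e))) →
                  Model G H
bijective⇒model {G} {H} onV onE (injV , surjV) injE joins =
  singletonBranches⇒model (just ∘ inverse) onV onE
    (λ x → cong just (injV (onV-inverse (onV x))))
    (λ {a} eq → trans (sym (onV-inverse a)) (cong onV (Maybe.just-injective eq)))
    injE joins
  where
  inverse : Vertex H → Vertex G
  inverse a = proj₁ (surjV a)
  onV-inverse : ∀ a → onV (inverse a) ≡ a
  onV-inverse a = proj₂ (surjV a) refl

vertexDeletion⇒model : ∀ {G H} → IsolatedVertexDeletion G H → Model G H
vertexDeletion⇒model {G} {H} D = singletonBranches⇒model branch onV onE branch-onV branch⁻ (proj₁ bij-E) joins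
  where
  open IsolatedVertexDeletion D
  branch : Vertex H → Maybe (Vertex G)
  branch a with a Fin.≟ deleted
  ... | yes _ = nothing
  ... | no a≢ = just (proj₁ (Equivalence.from (image-V a) a≢))
  branch-onV : ∀ x → branch (onV x) ≡ just x
  branch-onV x with onV x Fin.≟ deleted
  ... | yes eq = contradiction eq (Equivalence.to (image-V (onV x)) (x , refl))
  ... | no a≢ = cong just (inj-V (proj₂ (Equivalence.from (image-V (onV x)) a≢)))
  branch⁻ : ∀ {a x} → branch a ≡ just x → a ≡ onV x
  branch⁻ {a} eq with a Fin.≟ deleted
  branch⁻ {a} refl | no a≢ = sym (proj₂ (Equivalence.from (image-V a) a≢))

-- The branch sets are the fibres of `onV`. By `kernel-V`, two vertices of one fibre are equal or
-- joined by the contracted edge, so a path with at most one edge connects them.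
contraction⇒model : ∀ {G H} → EdgeContraction G H → Model G H
contraction⇒model {G} {H} C = record
  { branch    = just ∘ onV
  ; inhabited = λ x → let a , p = surj-V x in a , cong just (p refl)
  ; connected = conn
  ; onE       = onE
  ; onE-inj   = inj-E
  ; onE-joins = λ e → ends e (joins e)
  }
  where
  open EdgeContraction C
  ends : ∀ e → Joins G e (onV (end₁ H (onE e))) (onV (end₂ H (onE e))) →
         ∃₂ λ a b → Joins H (onE e) a b × just (onV a) ≡ just (end₁ G e)
                                        × just (onV b) ≡ just (end₂ G e)
  ends e (inj₁ (p , q)) = _ , _ , inj₁ (refl , refl) , cong just (sym p) , cong just (sym q)
  ends e (inj₂ (p , q)) = _ , _ , inj₂ (refl , refl) , cong just (sym p) , cong just (sym q)
  conn : ∀ {x a b} → just (onV a) ≡ just x → just (onV b) ≡ just x →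
         ∃ λ (P : Path H a b) → All (λ c → just (onV c) ≡ just x) (vertices (walk P))
  conn {a = a} {b} p q
    with Equivalence.to (kernel-V a b) (Maybe.just-injective (trans p (sym q)))
  ... | inj₁ refl = path nil ([] ∷ []) , p ∷ []
  ... | inj₂ j    =
    path (cons contracted j nil) ((joins⇒≢ {H} j ∷ []) ∷ [] ∷ []) , p ∷ q ∷ []

⋖⇒model : ∀ {G H} → G ⋖ H → Model G H
⋖⇒model (deleteVertex D) = vertexDeletion⇒model D
⋖⇒model (deleteEdge D)   = bijective⇒model onV onE bij-V inj-E joins
  where open EdgeDeletion D
⋖⇒model (contractEdge C) = contraction⇒model C

≼⇒model : ∀ {G H} → G ≼ H → Model G H
≼⇒model (iso i)            = bijective⇒model onV onE bij-V (proj₁ bij-E) joins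
  where open _≅_ i
≼⇒model (step G≼K K⋖H) = compose (≼⇒model G≼K) (⋖⇒model K⋖H)

-- The two bounds.

module _ {G H : Graph} (M : Model G H) {D : ℕ} (isDiam : IsDiameter G [ D ]) where
  open Model M

  geodesic : ∀ x y → ∃ λ (Q : Path G x y) → IsShortest Q × #vertices Q ≤ suc D
  geodesic x y with distance G x y
  ... | d , isD with proj₂ isDiam x y d isD
  -- A finite diameter rules out the infinite distance, so a shortest path exists.
  geodesic x y | _ , (Q , refl) , shortest | [ le ] =
    Q , shortest , subst (_≤ suc D) (sym (#vertices≡1+#edges (walk Q))) (s≤s le)

  order≤sp+diam+1 : order G ≤ sp H + suc D
  order≤sp+diam+1 with order-dichotomy M
  ... | inj₁ le = ≤-trans le (ℕ.m≤m+n _ _)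
  ... | inj₂ (x , y , _ , bound) with Q , _ , Q≤D+1 ← geodesic x y =
    ≤-trans (proj₁ (bound Q)) (ℕ.+-monoʳ-≤ (sp H) Q≤D+1)

  -- If the bound fails, the geodesic `Q` is tight in `order-dichotomy`, and so is every path with
  -- as many vertices. All of these have the same edges, so `Q` is a unique shortest path and
  -- `#vertices Q` is at most `usp G`, hence at most `D`; the first bound for `Q` then contradicts
  -- the failure.
  order≤sp+diam : usp G ≤ D → order G ≤ sp H + D
  order≤sp+diam usp≤D with order-dichotomy M
  ... | inj₁ le = ≤-trans le (ℕ.m≤m+n _ _)
  ... | inj₂ (x , y , es , bound) with Q , shortest , Q≤D+1 ← geodesic x y =
    ℕ.≮⇒≥ λ sp+D<n →
      let sp+Q≤n : sp H + #vertices Q ≤ order G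
          sp+Q≤n = ≤-trans (ℕ.+-monoʳ-≤ (sp H) Q≤D+1)
                           (subst (_≤ order G) (sym (ℕ.+-suc (sp H) D)) sp+D<n)
          only : ∀ (Q′ : Path G x y) → #vertices Q′ ≡ #vertices Q → Identical Q′ Q
          only Q′ eq =
            -- Tightness sends the edges of `Q′` and of `Q` to the same list `es`.
            let same = map-injective onE-inj (trans
                  (proj₂ (bound Q′) (subst (λ k → sp H + k ≤ order G) (sym eq) sp+Q≤n))
                  (sym (proj₂ (bound Q) sp+Q≤n)))
            in edges-determine-vertices (walk Q′) (walk Q) same , same
          Q≤usp = proj₂ (proj₂ (paradeNumber G)) x y Q (shortest , only)
      in ℕ.<⇒≱ sp+D<n (≤-trans (proj₁ (bound Q)) (ℕ.+-monoʳ-≤ (sp H) (≤-trans Q≤usp usp≤D)))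

≤+⇒-≤ : ∀ {n f k} → n ≤ f + k → + n ℤ.- + k ℤ.≤ + f
≤+⇒-≤ {n} {f} {k} le = begin
  + n ℤ.- + k           ≤⟨ ℤ.+-monoˡ-≤ (ℤ.- + k) (ℤ.+≤+ le) ⟩
  + (f + k) ℤ.- + k     ≡⟨ ℤ.+-assoc (+ f) (+ k) (ℤ.- + k) ⟩
  + f ℤ.+ (+ k ℤ.- + k) ≡⟨ cong (λ i → + f ℤ.+ i) (ℤ.+-inverseʳ (+ k)) ⟩
  + f ℤ.+ + 0           ≡⟨ ℤ.+-identityʳ (+ f) ⟩
  + f                   ∎
  where open ℤ.≤-Reasoning

-- Keeping the diameter a variable `D` allows a split by finiteness; if it is infinite, both left
-- sides are minus infinity.
spectator-bounds : ∀ {G H D} → G ≼ H → IsDiameter G D →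
  ([ + order G ] ⊖ D ⊖ [ 1 ] ≤₋ [ + sp H ])
  × ([ usp G ] ≤⁺ D → [ + order G ] ⊖ D ≤₋ [ + sp H ])
spectator-bounds {D = ⊤⁺}        _   _      = (⊥₋≤ _) , λ _ → ⊥₋≤ _
spectator-bounds {G} {H} {[ D ]} G≼H isDiam =
    [ subst (ℤ._≤ + sp H) regroup (≤+⇒-≤ (order≤sp+diam+1 M isDiam)) ]
  , λ { [ usp≤D ] → [ ≤+⇒-≤ (order≤sp+diam M isDiam usp≤D) ] }
  where
  M = ≼⇒model G≼H
  regroup : + order G ℤ.- + suc D ≡ + order G ℤ.- + D ℤ.- + 1
  regroup = trans (cong (λ d → + order G ℤ.- + d) (ℕ.+-comm 1 D))
    (trans (cong (λ i → + order G ℤ.+ i) (ℤ.neg-distrib-+ (+ D) (+ 1)))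
           (sym (ℤ.+-assoc (+ order G) (ℤ.- + D) (ℤ.- + 1))))

theorem4p6 : ∀ (G : Graph) (f : ℕ) → IsSpectatorFloor G f →
    ([ + order G ] ⊖ diam G ⊖ [ 1 ] ≤₋ [ + f ])
    × ([ usp G ] ≤⁺ diam G → [ + order G ] ⊖ diam G ≤₋ [ + f ])
-- The floor is attained: it is `sp H` for some `H` with `G` as a minor.
theorem4p6 G _ ((_ , G≼H , refl) , _) = spectator-bounds G≼H (proj₂ (diameter G))
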